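{- Every graph $G$ with maximum degree $\Delta\geq 3$ is $\lceil\frac13(\Delta+2)\rceil$-choosable with clustering $\lceil\frac{19}{2}\Delta\rceil-17$.
   Context: Graphs are finite and simple. In a coloured graph the monochromatic subgraph is the spanning subgraph of edges whose endpoints have the same colour; its connected components are monochromatic components. A colouring has clustering $c$ if every monochromatic component has at most $c$ vertices. A $k$-list-assignment $L$ assigns to each vertex $v$ a set $L(v)$ of at least $k$ colours; an $L$-colouring colours each $v$ with a colour from $L(v)$. $G$ is $k$-choosable with clustering $c$ if for every $k$-list-assignment $L$, $G$ has an $L$-colouring with clustering $c$. -}

module Defs where

open import Data.Nat using (ℕ; suc; _+_; _*_; _∸_; _≤_; _/_; ⌈_/2⌉)
open import Data.Fin using (Fin)
open import Data.Bool using (Bool; true; false)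
open import Data.List using (List; length; filter; allFin)
open import Data.List.Relation.Unary.All using (All)
open import Data.List.Relation.Unary.Unique.Propositional using (Unique)
open import Data.List.Membership.Propositional using (_∈_)
open import Data.Product using (Σ; _×_; ∃)
open import Relation.Binary.PropositionalEquality using (_≡_; _≢_)
open import Relation.Nullary.Decidable using (T?)

record Graph (n : ℕ) : Set where
  field
    adj     : Fin n → Fin n → Bool
    symm    : ∀ u v → adj u v ≡ adj v u
    irrefl  : ∀ v → adj v v ≡ false
open Graph public

degree : ∀ {n} → Graph n → Fin n → ℕ
degree {n} G v = length (filter (λ w → T? (adj G v w)) (allFin n))

HasMaxDegree : ∀ {n} → Graph n → ℕ → Set
HasMaxDegree G Δ = (∀ v → degree G v ≤ Δ) × ∃ (λ v → degree G v ≡ Δ)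

Colouring : ℕ → Set
Colouring n = Fin n → ℕ

data MonoReach {n} (G : Graph n) (f : Colouring n) : Fin n → Fin n → Set where
  here : ∀ {u} → MonoReach G f u u
  step : ∀ {u x w} → adj G u x ≡ true → f u ≡ f x →
         MonoReach G f x w → MonoReach G f u w

-- every monochromatic component has at most c vertices:
-- any list of distinct vertices in the component of v has length ≤ c
HasClustering : ∀ {n} → Graph n → Colouring n → ℕ → Set
HasClustering {n} G f c =
  ∀ (v : Fin n) (ws : List (Fin n)) → Unique ws →
  All (MonoReach G f v) ws → length ws ≤ c

ListAssignment : ℕ → ℕ → Set
ListAssignment n k =
  Σ (Fin n → List ℕ) λ L → ∀ v → Unique (L v) × k ≤ length (L v)

IsLColouring : ∀ {n} → (Fin n → List ℕ) → Colouring n → Set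
IsLColouring L f = ∀ v → f v ∈ L v

ChoosableWithClustering : ∀ {n} → Graph n → ℕ → ℕ → Set
ChoosableWithClustering {n} G k c =
  (A : ListAssignment n k) →
  Σ (Colouring n) λ f → IsLColouring (Σ.proj₁ A) f × HasClustering G f c

-- ⌈(Δ+2)/3⌉ = ⌊(Δ+4)/3⌋
ceil-Δ+2/3 : ℕ → ℕ
ceil-Δ+2/3 Δ = (Δ + 4) / 3

-- ⌈19Δ/2⌉ - 17 (for Δ ≥ 3 this is ≥ 12, so truncated subtraction is exact)
clusterBound : ℕ → ℕ
clusterBound Δ = ⌈ 19 * Δ /2⌉ ∸ 17

{-# OPTIONS --safe #-}
module Submission where

-- Recolour greedily so as to decrease lexicographically the number of monochromatic edges and the number of
-- vertices in components with more than c vertices ("giants").  Once no two successive recolourings decrease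
-- the number of edges, 3k ≥ Δ + 2 makes every monochromatic degree at most 2, and every vertex v of degree 2 has a colour a
-- occurring on exactly two of its neighbours, both of them of degree at most 1.  Recolouring v by a keeps the
-- number of edges and merges the paths ending at these two neighbours into one component J v.  If J v has at most
-- c vertices for some v in a giant, this is progress.  Otherwise, as in Haxell's proof of her theorem on
-- independent transversals, we grow a list of vertices v₁, v₂, … whose sets J vᵢ are too large: v₁ lies in a
-- giant, and each later vertex is chosen in an earlier J vᵢ so that recolouring it extends no earlier J vⱼ.
-- At most 5Δ - 4 vertices are excluded per J vᵢ, while J vᵢ contains more than 5Δ - 4 vertices of degree 2
-- because c > 5Δ; so the list can be continued, and as the J vᵢ are disjoint it stops: some new u can be
-- recoloured without creating a giant.  This shrinks the first J vᵢ containing u, or a giant.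
-- For Δ = 3 there are two colours and no vertex of degree 2.

open import Defs
open import Data.Nat using (ℕ; zero; suc; _+_; _*_; _≤_; _<_; z≤n; s≤s; _≟_; _≤?_; _<?_; ⌈_/2⌉)
open import Data.Nat.Properties hiding (_≟_; _≤?_; _<?_)
open import Data.Bool using (true; T)
open import Data.Bool.Properties using (T-≡)
open import Data.Fin using (Fin)
import Data.Fin.Properties as Fin
open import Data.List using (List; []; _∷_; _++_; length; filter; allFin)
open import Data.List.Properties using (length-++; length-tabulate; filter-accept; filter-reject)
open import Data.List.Membership.Propositional using (_∈_; _∉_)
open import Data.List.Membership.Propositional.Properties
  using (∈-length; ∈-filter⁺; ∈-filter⁻; ∈-allFin; ∈-∃++; ∈-++⁺ˡ; ∈-++⁺ʳ; ∈-++⁻)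
open import Data.List.Relation.Unary.All as All using (All; []; _∷_)
open import Data.List.Relation.Unary.Any using (Any; here; there)
open import Data.List.Relation.Unary.AllPairs using ([]; _∷_)
open import Data.List.Relation.Unary.Unique.Propositional using (Unique)
import Data.List.Relation.Unary.Unique.Propositional.Properties as Unique
open import Data.Product using (Σ; ∃-syntax; _×_; _,_; proj₁; proj₂)
open import Data.Sum using (_⊎_; inj₁; inj₂; swap)
open import Data.Nat.DivMod using (_%_; m≡m%n+[m/n]*n; m%n<n)
open import Data.Nat.Induction using (<-wellFounded)
open import Induction.WellFounded using (Acc; acc)
import Data.List.Membership.DecPropositional as DecMembership
open import Data.Vec.Functional using (updateAt)
open import Data.Vec.Functional.Properties using (updateAt-updates; updateAt-minimal)
open import Function using (_∘_; const; id; case_of_; Equivalence)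
open import Relation.Nullary using (¬_; Dec; yes; no; contradiction; ¬?)
open import Relation.Nullary.Decidable using (T?; map′; _×-dec_)
open import Relation.Unary using (Decidable)
open import Relation.Binary.PropositionalEquality using (_≡_; _≢_; refl; sym; trans; cong; cong₂; subst; module ≡-Reasoning)
open import Data.Nat.Solver using (module +-*-Solver)

-- Counting in duplicate-free lists and finite sums.

scan : ∀ {A : Set} {P Q : A → Set} → (∀ x → P x ⊎ Q x) →
       ∀ xs → (∀ {x} → x ∈ xs → P x) ⊎ (∃[ x ] x ∈ xs × Q x)
scan P⊎Q [] = inj₁ λ ()
scan P⊎Q (x ∷ xs) with P⊎Q x | scan P⊎Q xs
... | inj₂ q | _                  = inj₂ (x , here refl , q)
... | inj₁ _ | inj₂ (y , y∈ , q) = inj₂ (y , there y∈ , q)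
... | inj₁ p | inj₁ ps           = inj₁ λ { (here refl) → p ; (there z∈) → ps z∈ }

module _ {A : Set} where

  unique⊆⇒length≤ : ∀ {xs ys : List A} → Unique xs → (∀ {x} → x ∈ xs → x ∈ ys) → length xs ≤ length ys
  unique⊆⇒length≤ [] _ = z≤n
  unique⊆⇒length≤ {x ∷ xs} {ys} (x∉ ∷ u) sub with ∈-∃++ (sub (here refl))
  ... | ys₁ , ys₂ , refl = begin
    suc (length xs)            ≤⟨ s≤s (unique⊆⇒length≤ u sub′) ⟩
    suc (length (ys₁ ++ ys₂))  ≡⟨ cong suc (length-++ ys₁) ⟩
    suc (length ys₁ + length ys₂) ≡⟨ sym (+-suc (length ys₁) _) ⟩
    length ys₁ + suc (length ys₂) ≡⟨ sym (length-++ ys₁) ⟩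
    length (ys₁ ++ x ∷ ys₂)    ∎
    where
    open ≤-Reasoning
    sub′ : ∀ {y} → y ∈ xs → y ∈ ys₁ ++ ys₂
    sub′ y∈ with ∈-++⁻ ys₁ (sub (there y∈))
    ... | inj₁ p           = ∈-++⁺ˡ p
    ... | inj₂ (here refl) = contradiction refl (All.lookup x∉ y∈)
    ... | inj₂ (there q)   = ∈-++⁺ʳ ys₁ q

  unique-∷ : ∀ {x} {xs : List A} → x ∉ xs → Unique xs → Unique (x ∷ xs)
  unique-∷ x∉ u = All.tabulate (λ y∈ x≡y → x∉ (subst (_∈ _) (sym x≡y) y∈)) ∷ u

  unique⊂⇒length< : ∀ {xs ys : List A} {y} → Unique xs → (∀ {x} → x ∈ xs → x ∈ ys) →
                    y ∈ ys → y ∉ xs → length xs < length ys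
  unique⊂⇒length< u sub y∈ y∉ =
    unique⊆⇒length≤ (unique-∷ y∉ u) λ { (here refl) → y∈ ; (there x∈) → sub x∈ }

  length-filter-split : ∀ {P : A → Set} (P? : Decidable P) xs →
                        length xs ≡ length (filter P? xs) + length (filter (¬? ∘ P?) xs)
  length-filter-split P? [] = refl
  length-filter-split P? (x ∷ xs) with P? x
  ... | yes _ = cong suc (length-filter-split P? xs)
  ... | no _  = trans (cong suc (length-filter-split P? xs)) (sym (+-suc _ _))

  length-filter-disjoint : ∀ {P Q : A → Set} (P? : Decidable P) (Q? : Decidable Q) → (∀ {x} → P x → ¬ Q x) →
                           ∀ xs → length (filter Q? xs) ≤ length (filter Q? (filter (¬? ∘ P?) xs))
  length-filter-disjoint P? Q? disj [] = z≤n
  length-filter-disjoint P? Q? disj (x ∷ xs) with P? x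
  ... | yes p rewrite filter-reject Q? {xs = xs} (disj p) = length-filter-disjoint P? Q? disj xs
  ... | no _ with Q? x
  ...   | yes _ = s≤s (length-filter-disjoint P? Q? disj xs)
  ...   | no _  = length-filter-disjoint P? Q? disj xs

  -- Classes of different values of `f` are disjoint, so deleting one class leaves the others
  -- intact.
  length*≤ : ∀ (f : A → ℕ) d {L} (xs : List A) → Unique L →
             (∀ {a} → a ∈ L → d ≤ length (filter (λ w → f w ≟ a) xs)) → length L * d ≤ length xs
  length*≤ f d xs [] h = z≤n
  length*≤ f d {a ∷ L} xs (a∉ ∷ u) h = begin
    d + length L * d                        ≤⟨ +-mono-≤ (h (here refl)) (length*≤ f d rest u h′) ⟩
    length (filter (λ w → f w ≟ a) xs) + length rest ≡⟨ sym (length-filter-split _ xs) ⟩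
    length xs ∎
    where
    open ≤-Reasoning
    rest : List A
    rest = filter (¬? ∘ (λ w → f w ≟ a)) xs
    h′ : ∀ {b} → b ∈ L → d ≤ length (filter (λ w → f w ≟ b) rest)
    h′ b∈ = ≤-trans (h (there b∈)) (length-filter-disjoint (λ w → f w ≟ a) _ (λ p q → All.lookup a∉ b∈ (trans (sym p) q)) xs)

  ∑ : List A → (A → ℕ) → ℕ
  ∑ []       g = 0
  ∑ (x ∷ xs) g = g x + ∑ xs g

  ∑-cong : ∀ {g h} → (∀ x → g x ≡ h x) → ∀ xs → ∑ xs g ≡ ∑ xs h
  ∑-cong e []       = refl
  ∑-cong e (x ∷ xs) = cong₂ _+_ (e x) (∑-cong e xs)

  ∑-+ : ∀ g h xs → ∑ xs (λ x → g x + h x) ≡ ∑ xs g + ∑ xs h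
  ∑-+ g h [] = refl
  ∑-+ g h (x ∷ xs) rewrite ∑-+ g h xs =
    solve 4 (λ a b c d → (a :+ b) :+ (c :+ d) := (a :+ c) :+ (b :+ d)) refl (g x) (h x) (∑ xs g) (∑ xs h)
    where open +-*-Solver

  ∑-* : ∀ k g xs → ∑ xs (λ x → k * g x) ≡ k * ∑ xs g
  ∑-* k g []       = sym (*-zeroʳ k)
  ∑-* k g (x ∷ xs) = trans (cong (k * g x +_) (∑-* k g xs)) (sym (*-distribˡ-+ k (g x) _))

𝟙 : ∀ {P : Set} → Dec P → ℕ
𝟙 (yes _) = 1
𝟙 (no _)  = 0

𝟙-cong : ∀ {P Q : Set} (p : Dec P) (q : Dec Q) → (P → Q) → (Q → P) → 𝟙 p ≡ 𝟙 q
𝟙-cong (yes _) (yes _) _ _ = refl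
𝟙-cong (no _)  (no _)  _ _ = refl
𝟙-cong (yes p) (no ¬q) f _ = contradiction (f p) ¬q
𝟙-cong (no ¬p) (yes q) _ g = contradiction (g q) ¬p

length-filter-filter : ∀ {A : Set} {P Q : A → Set} (P? : Decidable P) (Q? : Decidable Q) xs →
                       length (filter Q? (filter P? xs)) ≡ ∑ xs (λ x → 𝟙 (P? x) * 𝟙 (Q? x))
length-filter-filter P? Q? [] = refl
length-filter-filter P? Q? (x ∷ xs) with P? x
... | no _ = length-filter-filter P? Q? xs
... | yes _ with Q? x
...   | yes _ = cong suc (length-filter-filter P? Q? xs)
...   | no _  = length-filter-filter P? Q? xs

δ : ∀ {n} → Fin n → Fin n → ℕ
δ u v = 𝟙 (u Fin.≟ v)

∑-δ : ∀ {n} (v : Fin n) (g : Fin n → ℕ) → ∑ (allFin n) (λ u → δ u v * g u) ≡ g v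
∑-δ {n} v g = go (allFin n) (Unique.allFin⁺ n) (∈-allFin v)
  where
  absent : ∀ xs → v ∉ xs → ∑ xs (λ u → δ u v * g u) ≡ 0
  absent [] _ = refl
  absent (x ∷ xs) v∉ with x Fin.≟ v
  ... | yes refl = contradiction (here refl) v∉
  ... | no _     = absent xs (v∉ ∘ there)
  go : ∀ xs → Unique xs → v ∈ xs → ∑ xs (λ u → δ u v * g u) ≡ g v
  go (x ∷ xs) (x∉ ∷ u) v∈ with x Fin.≟ v | v∈
  ... | yes refl | _ = trans (cong₂ _+_ (*-identityˡ (g x)) (absent xs λ v∈′ → All.lookup x∉ v∈′ refl))
                             (+-identityʳ (g x))
  ... | no x≢v | here v≡x  = contradiction (sym v≡x) x≢v
  ... | no _   | there v∈′ = go xs u v∈′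

-- Neighbourhoods and their colour classes.

module Recolour {n : ℕ} (G : Graph n) where

  Adj : Fin n → Fin n → Set
  Adj u v = adj G u v ≡ true

  adj-sym : ∀ {u v} → Adj u v → Adj v u
  adj-sym {u} {v} e = trans (symm G v u) e

  adj-irrefl : ∀ {u} → ¬ Adj u u
  adj-irrefl {u} e with trans (sym e) (irrefl G u)
  ... | ()

  nbrs : Fin n → List (Fin n)
  nbrs v = filter (λ w → T? (adj G v w)) (allFin n)

  class : Colouring n → Fin n → ℕ → List (Fin n)
  class f v a = filter (λ w → f w ≟ a) (nbrs v)

  cnt : Colouring n → Fin n → ℕ → ℕ
  cnt f v a = length (class f v a)

  mdeg : Colouring n → Fin n → ℕ
  mdeg f v = cnt f v (f v)

  ∈nbrs⁺ : ∀ {v w} → Adj v w → w ∈ nbrs v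
  ∈nbrs⁺ {v} {w} e = ∈-filter⁺ _ (∈-allFin w) (Equivalence.from T-≡ e)

  ∈nbrs⁻ : ∀ {v w} → w ∈ nbrs v → Adj v w
  ∈nbrs⁻ w∈ = Equivalence.to T-≡ (proj₂ (∈-filter⁻ _ {xs = allFin n} w∈))

  ∈class⁺ : ∀ {f v w a} → Adj v w → f w ≡ a → w ∈ class f v a
  ∈class⁺ e c = ∈-filter⁺ _ (∈nbrs⁺ e) c

  ∈class⁻ : ∀ {f v w a} → w ∈ class f v a → Adj v w × f w ≡ a
  ∈class⁻ {v = v} w∈ with ∈-filter⁻ _ {xs = nbrs v} w∈
  ... | w∈n , c = ∈nbrs⁻ w∈n , c

  unique-nbrs : ∀ v → Unique (nbrs v)
  unique-nbrs v = Unique.filter⁺ _ (Unique.allFin⁺ n)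

  unique-class : ∀ f v a → Unique (class f v a)
  unique-class f v a = Unique.filter⁺ _ (unique-nbrs v)

  -- Recolouring one vertex and its effect on the energy.

  infixl 20 _[_≔_]
  _[_≔_] : Colouring n → Fin n → ℕ → Colouring n
  f [ v ≔ a ] = updateAt f v (const a)

  upd-at : ∀ f v a → (f [ v ≔ a ]) v ≡ a
  upd-at f v a = updateAt-updates v f

  upd-off : ∀ f {v w} a → w ≢ v → (f [ v ≔ a ]) w ≡ f w
  upd-off f {v} {w} a w≢v = updateAt-minimal w v f w≢v

  -- Every monochromatic edge is counted twice.
  energy : Colouring n → ℕ
  energy f = ∑ (allFin n) (mdeg f)

  private
    χ : Colouring n → Fin n → Fin n → ℕ → ℕ
    χ f v w a = 𝟙 (T? (adj G v w)) * 𝟙 (f w ≟ a)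
  
    cnt-∑ : ∀ f v a → cnt f v a ≡ ∑ (allFin n) (λ w → χ f v w a)
    cnt-∑ f v a = length-filter-filter _ _ (allFin n)

    χ-sym : ∀ f g v w a b → (f w ≡ a → g v ≡ b) → (g v ≡ b → f w ≡ a) → χ f v w a ≡ χ g w v b
    χ-sym f g v w a b h k = cong₂ _*_ (𝟙-cong (T? (adj G v w)) (T? (adj G w v)) (subst T (symm G v w)) (subst T (symm G w v)))
                              (𝟙-cong (f w ≟ a) (g v ≟ b) h k)
  
    χ-irrefl : ∀ f v a → χ f v v a ≡ 0
    χ-irrefl f v a rewrite irrefl G v = refl

    χ-cong : ∀ f g v w a b → (f w ≡ a → g w ≡ b) → (g w ≡ b → f w ≡ a) → χ f v w a ≡ χ g v w b
    χ-cong f g v w a b h k = cong (𝟙 (T? (adj G v w)) *_) (𝟙-cong (f w ≟ a) (g w ≟ b) h k)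

  module _ (f : Colouring n) (v : Fin n) (a : ℕ) where
    private
      f′ = f [ v ≔ a ]

      -- Only pairs in row `v` or column `v` change. Symmetry of adjacency turns column entries into
      -- row entries, and the diagonal vanishes by irreflexivity.
      pointwise : ∀ u w → χ f′ u w (f′ u) + (δ u v * χ f v w (f v) + δ w v * χ f v u (f v)) ≡
                          χ f u w (f u) + (δ u v * χ f v w a + δ w v * χ f v u a)
      pointwise u w with u Fin.≟ v | w Fin.≟ v
      ... | yes refl | yes refl
        rewrite χ-irrefl f′ v (f′ v) | χ-irrefl f v (f v) | χ-irrefl f v a = refl
      ... | yes refl | no w≢
        rewrite χ-cong f′ f v w (f′ v) a (λ e → trans (sym (upd-off f a w≢)) (trans e (upd-at f v a)))
                                        (λ e → trans (upd-off f a w≢) (trans e (sym (upd-at f v a)))) =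
          solve 2 (λ x y → x :+ ((y :+ con 0) :+ con 0) := y :+ ((x :+ con 0) :+ con 0)) refl (χ f v w a) (χ f v w (f v))
        where open +-*-Solver
      ... | no u≢ | yes refl
        rewrite χ-sym f′ f u v (f′ u) a (λ e → trans (sym (upd-off f a u≢)) (trans (sym e) (upd-at f v a)))
                                       (λ e → trans (upd-at f v a) (trans (sym e) (sym (upd-off f a u≢))))
              | χ-sym f f u v (f u) (f v) sym sym =
          solve 2 (λ x y → x :+ (y :+ con 0) := y :+ (x :+ con 0)) refl (χ f v u a) (χ f v u (f v))
        where open +-*-Solver
      ... | no u≢ | no w≢
        rewrite χ-cong f′ f u w (f′ u) (f u) (λ e → trans (sym (upd-off f a w≢)) (trans e (upd-off f a u≢)))
                                             (λ e → trans (upd-off f a w≢) (trans e (sym (upd-off f a u≢)))) = refl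

      total : ∀ (g : Colouring n) b → ∑ (allFin n) (λ u → ∑ (allFin n) λ w → χ g u w (g u) + (δ u v * χ f v w b + δ w v * χ f v u b))
              ≡ energy g + (cnt f v b + cnt f v b)
      total g b = begin
        ∑ V (λ u → ∑ V λ w → χ g u w (g u) + (δ u v * χ f v w b + δ w v * χ f v u b))
          ≡⟨ ∑-cong (λ u → inner u) V ⟩
        ∑ V (λ u → mdeg g u + (δ u v * cnt f v b + χ f v u b))
          ≡⟨ ∑-+ (mdeg g) _ V ⟩
        energy g + ∑ V (λ u → δ u v * cnt f v b + χ f v u b)
          ≡⟨ cong (energy g +_) (∑-+ _ _ V) ⟩
        energy g + (∑ V (λ u → δ u v * cnt f v b) + ∑ V (λ u → χ f v u b))
          ≡⟨ cong (energy g +_) (cong₂ _+_ (∑-δ v (const (cnt f v b))) (sym (cnt-∑ f v b))) ⟩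
        energy g + (cnt f v b + cnt f v b) ∎
        where
        open ≡-Reasoning
        V = allFin n
        inner : ∀ u → ∑ V (λ w → χ g u w (g u) + (δ u v * χ f v w b + δ w v * χ f v u b)) ≡
                      mdeg g u + (δ u v * cnt f v b + χ f v u b)
        inner u = begin
          ∑ V (λ w → χ g u w (g u) + (δ u v * χ f v w b + δ w v * χ f v u b))
            ≡⟨ ∑-+ _ _ V ⟩
          ∑ V (λ w → χ g u w (g u)) + ∑ V (λ w → δ u v * χ f v w b + δ w v * χ f v u b)
            ≡⟨ cong₂ _+_ (sym (cnt-∑ g u (g u))) (∑-+ _ _ V) ⟩
          mdeg g u + (∑ V (λ w → δ u v * χ f v w b) + ∑ V (λ w → δ w v * χ f v u b))
            ≡⟨ cong (mdeg g u +_) (cong₂ _+_ (trans (∑-* (δ u v) _ V) (cong (δ u v *_) (sym (cnt-∑ f v b))))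
                                             (∑-δ v (const (χ f v u b)))) ⟩
          mdeg g u + (δ u v * cnt f v b + χ f v u b) ∎

    -- Obtained by summing `pointwise` over all pairs; the lost edges stand on the left to avoid
    -- truncated subtraction.
    energy-upd : energy f′ + (mdeg f v + mdeg f v) ≡ energy f + (cnt f v a + cnt f v a)
    energy-upd = trans (sym (total f′ (f v)))
                   (trans (∑-cong (λ u → ∑-cong (pointwise u) (allFin n)) (allFin n)) (total f a))

    energy-≤ : cnt f v a ≤ mdeg f v → energy f′ ≤ energy f
    energy-≤ le = +-cancelʳ-≤ (mdeg f v + mdeg f v) (energy f′) (energy f)
      (≤-trans (≤-reflexive energy-upd) (+-monoʳ-≤ (energy f) (+-mono-≤ le le)))

    energy-< : cnt f v a < mdeg f v → energy f′ < energy f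
    energy-< lt = +-cancelʳ-< (mdeg f v + mdeg f v) (energy f′) (energy f)
      (≤-<-trans (≤-reflexive energy-upd) (+-monoʳ-< (energy f) (+-mono-< lt lt)))

  -- Monochromatic components.

  Mono : Colouring n → Fin n → Fin n → Set
  Mono f u w = Adj u w × f u ≡ f w

  mono-sym : ∀ {f u w} → Mono f u w → Mono f w u
  mono-sym (e , c) = adj-sym e , sym c

  reach-trans : ∀ {f u v w} → MonoReach G f u v → MonoReach G f v w → MonoReach G f u w
  reach-trans here         r = r
  reach-trans (step e c s) r = step e c (reach-trans s r)

  reach-snoc : ∀ {f u v w} → MonoReach G f u v → Mono f v w → MonoReach G f u w
  reach-snoc r (e , c) = reach-trans r (step e c here)

  reach-sym : ∀ {f u v} → MonoReach G f u v → MonoReach G f v u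
  reach-sym here         = here
  reach-sym (step e c r) = reach-snoc (reach-sym r) (mono-sym (e , c))

  reach-colour : ∀ {f u v} → MonoReach G f u v → f u ≡ f v
  reach-colour here         = refl
  reach-colour (step _ c r) = trans c (reach-colour r)

  reach-closed : ∀ {f u w} (P : Fin n → Set) → (∀ {x y} → P x → Mono f x y → P y) →
                 P u → MonoReach G f u w → P w
  reach-closed P cl p here         = p
  reach-closed P cl p (step e c r) = reach-closed P cl (cl p (e , c)) r

  unique-length≤n : ∀ {xs : List (Fin n)} → Unique xs → length xs ≤ n
  unique-length≤n u = ≤-trans (unique⊆⇒length≤ u λ _ → ∈-allFin _) (≤-reflexive (length-tabulate id))

  infix 4 _∈?_
  _∈?_ : (x : Fin n) (xs : List (Fin n)) → Dec (x ∈ xs)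
  _∈?_ = DecMembership._∈?_ Fin._≟_

  mono-nbrs : Colouring n → Fin n → List (Fin n)
  mono-nbrs f v = class f v (f v)

  ∈mono⁺ : ∀ {f v w} → Mono f v w → w ∈ mono-nbrs f v
  ∈mono⁺ (e , c) = ∈class⁺ e (sym c)

  ∈mono⁻ : ∀ {f v w} → w ∈ mono-nbrs f v → Mono f v w
  ∈mono⁻ w∈ with ∈class⁻ w∈
  ... | e , c = e , sym c

  exit? : ∀ f v ws → (∀ {z} → Mono f v z → z ∈ ws) ⊎ ∃[ z ] Mono f v z × z ∉ ws
  exit? f v ws with scan {P = _∈ ws} {Q = _∉ ws} dec (mono-nbrs f v)
    where
    dec : ∀ z → z ∈ ws ⊎ z ∉ ws
    dec z with z ∈? ws
    ... | yes p = inj₁ p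
    ... | no ¬p = inj₂ ¬p
  ... | inj₁ all            = inj₁ λ m → all (∈mono⁺ m)
  ... | inj₂ (z , z∈ , z∉) = inj₂ (z , ∈mono⁻ z∈ , z∉)

  record Component (f : Colouring n) (v : Fin n) : Set where
    field
      members  : List (Fin n)
      unique   : Unique members
      sound    : ∀ {w} → w ∈ members → MonoReach G f v w
      complete : ∀ {w} → MonoReach G f v w → w ∈ members

  private
    -- One outside neighbour is added at a time. The fuel `k` cannot run out, since a duplicate-free
    -- list has at most `n` vertices.
    grow : ∀ f v k ws → n < k + length ws → Unique ws → v ∈ ws →
           (∀ {w} → w ∈ ws → MonoReach G f v w) → Component f v
    grow f v zero ws lt u _ _ = contradiction (unique-length≤n u) (<⇒≱ lt)
    grow f v (suc k) ws lt u v∈ r with scan {P = λ w → ∀ {z} → Mono f w z → z ∈ ws} (λ w → exit? f w ws) ws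
    ... | inj₁ closed = record
      { members = ws ; unique = u ; sound = r
      ; complete = reach-closed (_∈ ws) (λ x∈ m → closed x∈ m) v∈ }
    ... | inj₂ (w , w∈ , z , m , z∉) =
      grow f v k (z ∷ ws) (≤-trans lt (≤-reflexive (sym (+-suc k _)))) (unique-∷ z∉ u) (there v∈)
        λ { (here refl) → reach-snoc (r w∈) m ; (there x∈) → r x∈ }

  component : ∀ f v → Component f v
  component f v = grow f v n (v ∷ []) (≤-reflexive (+-comm 1 n)) ([] ∷ []) (here refl)
                    λ { (here refl) → here }

  comp : Colouring n → Fin n → List (Fin n)
  comp f v = Component.members (component f v)

  comp-unique : ∀ f v → Unique (comp f v)
  comp-unique f v = Component.unique (component f v)

  ∈comp⁺ : ∀ {f v w} → MonoReach G f v w → w ∈ comp f v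
  ∈comp⁺ {f} {v} = Component.complete (component f v)

  ∈comp⁻ : ∀ {f v w} → w ∈ comp f v → MonoReach G f v w
  ∈comp⁻ {f} {v} = Component.sound (component f v)

  size : Colouring n → Fin n → ℕ
  size f v = length (comp f v)

  size-mono : ∀ {f g v} → (∀ {w} → MonoReach G f v w → MonoReach G g v w) → size f v ≤ size g v
  size-mono {f} {g} {v} h = unique⊆⇒length≤ (comp-unique f v) λ w∈ → ∈comp⁺ (h (∈comp⁻ w∈))

  size-strict : ∀ {f g v u} → (∀ {w} → MonoReach G f v w → MonoReach G g v w) →
                MonoReach G g v u → ¬ MonoReach G f v u → size f v < size g v
  size-strict {f} {g} {v} h r ¬r =
    unique⊂⇒length< (comp-unique f v) (λ w∈ → ∈comp⁺ (h (∈comp⁻ w∈))) (∈comp⁺ r) λ u∈ → ¬r (∈comp⁻ u∈)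

  reach-equiv-size : ∀ {f u v} → MonoReach G f u v → size f u ≡ size f v
  reach-equiv-size {f} {u} {v} r = ≤-antisym
    (unique⊆⇒length≤ (comp-unique f u) λ w∈ → ∈comp⁺ (reach-trans (reach-sym r) (∈comp⁻ w∈)))
    (unique⊆⇒length≤ (comp-unique f v) λ w∈ → ∈comp⁺ (reach-trans r (∈comp⁻ w∈)))

  -- If every monochromatic degree is at most 2, the component of a vertex x of degree at most 1 is a path
  -- starting at x; h is the head of the initial segment walked so far.
  module Path (f : Colouring n) (deg≤2 : ∀ v → mdeg f v ≤ 2) (x : Fin n) (degx≤1 : mdeg f x ≤ 1) where

    deg≥2 : ∀ {v y z} → Mono f v y → Mono f v z → y ≢ z → 2 ≤ mdeg f v
    deg≥2 {v} my mz y≢z = unique⊆⇒length≤ ((y≢z ∷ []) ∷ [] ∷ [])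
      λ { (here refl) → ∈mono⁺ my ; (there (here refl)) → ∈mono⁺ mz }

    third-nbr : ∀ {v y z w} → Mono f v y → Mono f v z → y ≢ z → Mono f v w → w ≡ y ⊎ w ≡ z
    third-nbr {v} {y} {z} {w} my mz y≢z mw with w Fin.≟ y | w Fin.≟ z
    ... | yes e | _ = inj₁ e
    ... | no _ | yes e = inj₂ e
    ... | no w≢y | no w≢z = contradiction (deg≤2 v) (<⇒≱ (unique⊆⇒length≤
      ((w≢y ∷ w≢z ∷ []) ∷ (y≢z ∷ []) ∷ [] ∷ [])
      λ { (here refl) → ∈mono⁺ mw ; (there (here refl)) → ∈mono⁺ my ; (there (there (here refl))) → ∈mono⁺ mz }))

    only-nbr : ∀ {z w} → Mono f x z → Mono f x w → w ≡ z
    only-nbr {z} {w} mz mw with w Fin.≟ z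
    ... | yes e = e
    ... | no w≢z = contradiction degx≤1 (<⇒≱ (deg≥2 mw mz w≢z))

    -- `nonempty` serves the later counting: unless `x` is alone in its component, each path end
    -- spends one of its neighbours on its own colour.
    record End : Set where
      field
        end       : Fin n
        deficient : ∀ {z} → MonoReach G f x z → mdeg f z ≤ 1 → z ≡ x ⊎ z ≡ end
        nonempty  : (∀ z → MonoReach G f x z → z ≡ x) ⊎ (1 ≤ mdeg f x × 1 ≤ mdeg f end)

    private
      -- Invariant for visited vertices behind the head: the component cannot be left there, and
      -- none of them except `x` is an end.
      Inner : List (Fin n) → Fin n → Set
      Inner p z = (∀ {w} → Mono f z w → w ∈ p) × (z ≡ x ⊎ 2 ≤ mdeg f z)

      Head : List (Fin n) → Fin n → Set
      Head p h = (h ≡ x × (∀ {z} → z ∈ p → z ≡ x)) ⊎ (1 ≤ mdeg f x × ∃[ y ] y ∈ p × Mono f h y)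

      walk : ∀ k p h → n < k + length p → Unique p → x ∈ p → h ∈ p →
             (∀ {z} → z ∈ p → z ≡ h ⊎ Inner p z) → Head p h → End
      walk zero p h lt u _ _ _ _ = contradiction (unique-length≤n u) (<⇒≱ lt)
      walk (suc k) p h lt u x∈ h∈ inv hd with exit? f h p
      ... | inj₁ stop = record
        { end = h
        ; deficient = λ r d → case inv (in-p r) of λ
            { (inj₁ e) → inj₂ e ; (inj₂ (_ , inj₁ e)) → inj₁ e
            ; (inj₂ (_ , inj₂ d≥2)) → contradiction d (<⇒≱ d≥2) }
        ; nonempty = case hd of λ
            { (inj₁ (_ , only)) → inj₁ (λ _ r → only (in-p r))
            ; (inj₂ (dx , y , _ , m)) → inj₂ (dx , ∈-length (∈mono⁺ m)) } }
        where
        closed : ∀ {z} → z ∈ p → ∀ {w} → Mono f z w → w ∈ p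
        closed z∈ with inv z∈
        ... | inj₁ refl     = stop
        ... | inj₂ (cl , _) = cl
        in-p : ∀ {z} → MonoReach G f x z → z ∈ p
        in-p = reach-closed (_∈ p) (λ z∈ m → closed z∈ m) x∈
      ... | inj₂ (z , m , z∉) =
        walk k (z ∷ p) z (≤-trans lt (≤-reflexive (sym (+-suc k _)))) (unique-∷ z∉ u) (there x∈) (here refl) inv′ (hd′ hd)
        where
        inner-h : Head p h → Inner (z ∷ p) h
        inner-h (inj₁ (refl , _)) = (λ mw → here (only-nbr m mw)) , inj₁ refl
        -- The predecessor `y` is visited and `z` is not, so these are two different neighbours of
        -- the head, and there is no third.
        inner-h (inj₂ (_ , y , y∈ , my)) =
          (λ mw → case third-nbr my m y≢z mw of λ { (inj₁ refl) → there y∈ ; (inj₂ refl) → here refl }) ,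
          inj₂ (deg≥2 my m y≢z)
          where
          y≢z : y ≢ z
          y≢z refl = z∉ y∈
        inv′ : ∀ {w} → w ∈ z ∷ p → w ≡ z ⊎ Inner (z ∷ p) w
        inv′ (here e) = inj₁ e
        inv′ (there w∈) with inv w∈
        ... | inj₁ refl    = inj₂ (inner-h hd)
        ... | inj₂ (cl , d) = inj₂ ((λ mw → there (cl mw)) , d)
        hd′ : Head p h → Head (z ∷ p) z
        hd′ (inj₁ (refl , _)) = inj₂ (∈-length (∈mono⁺ m) , h , there h∈ , mono-sym m)
        hd′ (inj₂ (dx , _))   = inj₂ (dx , h , there h∈ , mono-sym m)

    path-end : End
    path-end = walk n (x ∷ []) x (≤-reflexive (+-comm 1 n)) ([] ∷ []) (here refl) (here refl)
      (λ { (here e) → inj₁ e }) (inj₁ (refl , λ { (here e) → e }))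

any-all : ∀ {A : Set} {P Q R : A → Set} {xs} → (∀ {x} → P x → Q x → R x) → All P xs → Any Q xs → Any R xs
any-all h (p ∷ _)  (here q)  = here (h p q)
any-all h (_ ∷ ps) (there q) = there (any-all h ps q)

all-any : ∀ {A : Set} {P Q : A → Set} {xs} → (∀ {x} → P x → ¬ Q x) → All P xs → ¬ Any Q xs
all-any h (p ∷ _)  (here q)  = h p q
all-any h (_ ∷ ps) (there q) = all-any h ps q

pigeonhole : ∀ {n} {xs ys : List (Fin n)} → Unique xs → length ys < length xs → ∃[ x ] x ∈ xs × x ∉ ys
pigeonhole {xs = xs} {ys} u lt with scan {P = _∈ ys} {Q = _∉ ys} (λ x → fromDec (DecMembership._∈?_ Fin._≟_ x ys)) xs
  where
  fromDec : ∀ {P : Set} → Dec P → P ⊎ ¬ P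
  fromDec (yes p) = inj₁ p
  fromDec (no ¬p) = inj₂ ¬p
... | inj₁ xs⊆ys = contradiction (unique⊆⇒length≤ u xs⊆ys) (<⇒≱ lt)
... | inj₂ found = found

-- Asking for `5 * Δ < c` only under `k * 2 ≤ Δ` admits Δ = 3, where k = 2 and c = 12.
module Clustering {n : ℕ} (G : Graph n) (Δ k c : ℕ) (degree≤ : ∀ v → degree G v ≤ Δ) (Δ+2≤3k : Δ + 2 ≤ k * 3)
                  (2≤c : 2 ≤ c) (2k≤Δ⇒5Δ<c : k * 2 ≤ Δ → 5 * Δ < c) (A : ListAssignment n k) where

  open Recolour G

  L : Fin n → List ℕ
  L = proj₁ A

  unique-L : ∀ v → Unique (L v)
  unique-L v = proj₁ (proj₂ A v)

  k≤L : ∀ v → k ≤ length (L v)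
  k≤L v = proj₂ (proj₂ A v)

  -- Local optimality and movable vertices.

  LocOpt : Colouring n → Set
  LocOpt f = ∀ v {a} → a ∈ L v → mdeg f v ≤ cnt f v a

  -- Inequalities rather than equalities, because these directions survive the later moves
  -- (`movable-kept`); together they ensure that the recolouring costs no energy.
  record Movable (f : Colouring n) (v : Fin n) (a : ℕ) : Set where
    constructor movable
    field
      allowed  : a ∈ L v
      new      : a ≢ f v
      cnt≤2    : cnt f v a ≤ 2
      interior : 2 ≤ mdeg f v

    cnt≤mdeg : cnt f v a ≤ mdeg f v
    cnt≤mdeg = ≤-trans cnt≤2 interior

  open Movable

  -- v itself is listed with its neighbours, so that 3k > Δ + 1 forces a colour of L v to occur at most twice.
  rare-colour : ∀ f v → mdeg f v ≤ 1 ⊎ ∃[ a ] a ∈ L v × a ≢ f v × cnt f v a ≤ 2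
  rare-colour f v with scan {P = λ a → 3 ≤ occ a} {Q = λ a → occ a ≤ 2} split (L v)
    where
    occ : ℕ → ℕ
    occ a = length (filter (λ w → f w ≟ a) (v ∷ nbrs v))
    split : ∀ a → 3 ≤ occ a ⊎ occ a ≤ 2
    split a with 3 ≤? occ a
    ... | yes p = inj₁ p
    ... | no ¬p = inj₂ (≤-pred (≰⇒> ¬p))
  ... | inj₁ often = contradiction (length*≤ f 3 (v ∷ nbrs v) (unique-L v) often) (<⇒≱ (begin
    suc (suc (length (nbrs v)))  ≤⟨ s≤s (s≤s (degree≤ v)) ⟩
    2 + Δ                        ≡⟨ +-comm 2 Δ ⟩
    Δ + 2                        ≤⟨ Δ+2≤3k ⟩
    k * 3                        ≤⟨ *-monoˡ-≤ 3 (k≤L v) ⟩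
    length (L v) * 3             ∎))
    where open ≤-Reasoning
  ... | inj₂ (a , a∈ , few) with f v ≟ a
  ...   | yes refl = inj₁ (≤-pred (≤-trans (≤-reflexive (cong length (sym (filter-accept (λ w → f w ≟ a) {xs = nbrs v} refl)))) few))
  ...   | no f≢a   = inj₂ (a , a∈ , f≢a ∘ sym ,
    ≤-trans (≤-reflexive (cong length (sym (filter-reject (λ w → f w ≟ a) {xs = nbrs v} f≢a)))) few)

  mdeg≤2 : ∀ {f} → LocOpt f → ∀ v → mdeg f v ≤ 2
  mdeg≤2 {f} opt v with rare-colour f v
  ... | inj₁ d≤1                = m≤n⇒m≤1+n d≤1
  ... | inj₂ (a , a∈ , _ , few) = ≤-trans (opt v a∈) few

  movable-colour : ∀ {f v} → 2 ≤ mdeg f v → ∃[ a ] Movable f v a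
  movable-colour {f} {v} d≥2 with rare-colour f v
  ... | inj₁ d≤1                  = contradiction d≤1 (<⇒≱ d≥2)
  ... | inj₂ (a , a∈ , a≢ , few) = a , movable a∈ a≢ few d≥2

  -- By local optimality every colour of `L v` occurs on at least two neighbours. This gives access
  -- to `5 * Δ < c`.
  interior⇒2k≤Δ : ∀ {f v} → LocOpt f → 2 ≤ mdeg f v → k * 2 ≤ Δ
  interior⇒2k≤Δ {f} {v} opt d≥2 = begin
    k * 2             ≤⟨ *-monoˡ-≤ 2 (k≤L v) ⟩
    length (L v) * 2  ≤⟨ length*≤ f 2 (nbrs v) (unique-L v) (λ a∈ → ≤-trans d≥2 (opt v a∈)) ⟩
    length (nbrs v)   ≤⟨ degree≤ v ⟩
    Δ                 ∎
    where open ≤-Reasoning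

  -- If either half fails, at most two recolourings lower the energy (`opt?`). The second half is
  -- what `target-deficient` rests on.
  Opt : Colouring n → Set
  Opt f = LocOpt f × (∀ v {a} → a ∈ L v → cnt f v a ≤ mdeg f v → LocOpt (f [ v ≔ a ]))

  -- Components created by a recolouring.

  J : Colouring n → Fin n → ℕ → Fin n → Set
  J f v a w = MonoReach G (f [ v ≔ a ]) v w

  J-size : Colouring n → Fin n → ℕ → ℕ
  J-size f v a = size (f [ v ≔ a ]) v

  -- For `a` different from `f v`, leaving out `v` gives a union of components of `f` itself, all of
  -- colour `a`.
  J° : Colouring n → Fin n → ℕ → Fin n → Set
  J° f v a w = J f v a w × w ≢ v

  J? : ∀ f v a w → Dec (J f v a w)
  J? f v a w = map′ ∈comp⁻ ∈comp⁺ (w ∈? comp (f [ v ≔ a ]) v)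

  J°-colour : ∀ {f v a w} → J° f v a w → f w ≡ a
  J°-colour {f} {v} {a} {w} (r , w≢v) =
    trans (sym (upd-off f a w≢v)) (trans (sym (reach-colour r)) (upd-at f v a))

  J°-closed : ∀ {f v a w z} → a ≢ f v → J° f v a w → MonoReach G f w z → J° f v a z
  J°-closed {f} {v} {a} new j r = reach-closed (J° f v a) one j r
    where
    one : ∀ {x y} → J° f v a x → Mono f x y → J° f v a y
    one {x} {y} j@(rx , x≢v) (e , fx≡fy) =
      reach-snoc rx (e , trans (upd-off f a x≢v) (trans fx≡fy (sym (upd-off f a y≢v)))) , y≢v
      where
      y≢v : y ≢ v
      y≢v refl = new (trans (sym (J°-colour j)) fx≡fy)

  -- After its last visit to `v` the walk is also a walk under `f`, and this part starts at a
  -- neighbour of `v` of colour `a`.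
  J°-seed : ∀ {f v a w} → J° f v a w → ∃[ x ] x ∈ class f v a × MonoReach G f x w
  J°-seed {f} {v} {a} (r , w≢v) with go r
    where
    g = f [ v ≔ a ]
    go : ∀ {s w} → MonoReach G g s w →
         w ≡ v ⊎ (∃[ x ] x ∈ class f v a × MonoReach G f x w) ⊎ (s ≢ v × MonoReach G f s w)
    go {s} here with s Fin.≟ v
    ... | yes s≡v = inj₁ s≡v
    ... | no s≢v  = inj₂ (inj₂ (s≢v , here))
    go {s} (step {x = x} e c r) with go r
    ... | inj₁ w≡v         = inj₁ w≡v
    ... | inj₂ (inj₁ seed) = inj₂ (inj₁ seed)
    ... | inj₂ (inj₂ (x≢v , r′)) with s Fin.≟ v
    ...   | yes refl = inj₂ (inj₁ (x , ∈class⁺ e (trans (sym (upd-off f a x≢v)) (trans (sym c) (upd-at f v a))) , r′))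
    ...   | no s≢v   = inj₂ (inj₂ (s≢v , step e (trans (sym (upd-off f a s≢v)) (trans c (upd-off f a x≢v))) r′))
  ... | inj₁ w≡v               = contradiction w≡v w≢v
  ... | inj₂ (inj₁ seed)       = seed
  ... | inj₂ (inj₂ (v≢v , _)) = contradiction refl v≢v

  -- Two-step optimality: recolouring u must not give w a monochromatic degree above 2.
  target-deficient : ∀ {f u b w} → Opt f → Movable f u b → w ∈ class f u b → mdeg f w ≤ 1
  target-deficient {f} {u} {b} {w} (_ , opt₂) m w∈ with ∈class⁻ w∈
  ... | u~w , fw≡b = ≤-pred (≤-trans (unique⊆⇒length≤ (unique-∷ u∉ (unique-class f w (f w))) sub)
                                     (mdeg≤2 (opt₂ u (allowed m) (cnt≤mdeg m)) w))
    where
    g = f [ u ≔ b ]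
    w≢u : w ≢ u
    w≢u refl = adj-irrefl u~w
    gw≡b : g w ≡ b
    gw≡b = trans (upd-off f b w≢u) fw≡b
    u∉ : u ∉ mono-nbrs f w
    u∉ u∈ = new m (trans (sym fw≡b) (proj₂ (∈mono⁻ u∈)))
    sub : ∀ {z} → z ∈ u ∷ mono-nbrs f w → z ∈ mono-nbrs g w
    sub (here refl) = ∈mono⁺ (adj-sym u~w , trans gw≡b (sym (upd-at f u b)))
    sub {z} (there z∈) with z Fin.≟ u | ∈mono⁻ z∈
    ... | yes refl | _       = contradiction z∈ u∉
    ... | no z≢u   | w~z , c = ∈mono⁺ (w~z , trans (upd-off f b w≢u) (trans c (sym (upd-off f b z≢u))))

  -- (v , a , β): v is to be recoloured by a, and J f v a has at most β vertices; β is the variant that decreases.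
  Entry : Set
  Entry = Fin n × ℕ × ℕ

  -- Under this condition, recolouring a vertex `u` other than `v` by `a` cannot enlarge the set `J`
  -- of the entry.
  Clear : Colouring n → Fin n → ℕ → Entry → Set
  Clear f u a (v , b , _) = ∀ {w} → J f v b w → Adj u w → a ≢ b

  InJ° : Colouring n → Fin n → Entry → Set
  InJ° f u (v , b , _) = J° f v b u

  -- Ensures that recolouring `u` without creating a giant is progress: a giant or an earlier set
  -- loses `u`.
  Located : Colouring n → Fin n → List Entry → Set
  Located f u Γ = c < size f u ⊎ Any (InJ° f u) Γ

  giants : Colouring n → List (Fin n)
  giants f = filter (λ w → c <? size f w) (allFin n)

  ∈giants⁺ : ∀ {f w} → c < size f w → w ∈ giants f
  ∈giants⁺ {w = w} = ∈-filter⁺ _ (∈-allFin w)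

  ∈giants⁻ : ∀ {f w} → w ∈ giants f → c < size f w
  ∈giants⁻ w∈ = proj₂ (∈-filter⁻ _ {xs = allFin n} w∈)

  unique-giants : ∀ f → Unique (giants f)
  unique-giants f = Unique.filter⁺ _ (Unique.allFin⁺ n)

  others : Colouring n → Fin n → List (Fin n)
  others f v = filter (¬? ∘ (λ w → f w ≟ f v)) (nbrs v)

  ∈others : ∀ {f v w} → Adj v w → f w ≢ f v → w ∈ others f v
  ∈others e ne = ∈-filter⁺ _ (∈nbrs⁺ e) ne

  others+1≤Δ : ∀ f v → 1 ≤ mdeg f v → suc (length (others f v)) ≤ Δ
  others+1≤Δ f v d = begin
    suc (length (others f v))       ≤⟨ +-monoˡ-≤ (length (others f v)) d ⟩
    mdeg f v + length (others f v)  ≡⟨ sym (length-filter-split (λ w → f w ≟ f v) (nbrs v)) ⟩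
    length (nbrs v)                 ≤⟨ degree≤ v ⟩
    Δ                               ∎
    where open ≤-Reasoning

  -- Counting available against excluded vertices.

  module Zone (f : Colouring n) (opt : Opt f) (2≤Δ : 2 ≤ Δ) where

    -- `xs` are starting points of paths. `outer≤` expresses, without subtraction, a bound of 2Δ - 2
    -- outer vertices per path.
    record Ends (xs : List (Fin n)) : Set where
      field
        ends        : List (Fin n)
        outer       : List (Fin n)
        ends≤       : length ends ≤ length xs * 2
        outer≤      : length outer + length xs * 2 ≤ length xs * (2 * Δ)
        ∈ends       : ∀ {x w} → x ∈ xs → MonoReach G f x w → mdeg f w ≤ 1 → w ∈ ends
        ∈outer      : ∀ {x w u} → x ∈ xs → MonoReach G f x w → mdeg f w ≤ 1 → Adj w u → f u ≢ f w → u ∈ outer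

    ends-++ : ∀ {x xs} → Ends (x ∷ []) → Ends xs → Ends (x ∷ xs)
    ends-++ {x} {xs} E F = record
      { ends   = E.ends ++ F.ends
      ; outer  = E.outer ++ F.outer
      ; ends≤  = ≤-trans (≤-reflexive (length-++ E.ends)) (+-mono-≤ E.ends≤ F.ends≤)
      ; outer≤ = begin
          length (E.outer ++ F.outer) + (2 + length xs * 2)
            ≡⟨ cong (_+ (2 + length xs * 2)) (length-++ E.outer) ⟩
          (length E.outer + length F.outer) + (2 + length xs * 2)
            ≡⟨ solve 3 (λ a b c → (a :+ b) :+ (con 2 :+ c) := (a :+ con 2) :+ (b :+ c)) refl (length E.outer) _ (length xs * 2) ⟩
          (length E.outer + 2) + (length F.outer + length xs * 2)
            ≤⟨ +-mono-≤ E.outer≤ F.outer≤ ⟩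
          1 * (2 * Δ) + length xs * (2 * Δ)
            ≡⟨ cong (_+ length xs * (2 * Δ)) (*-identityˡ (2 * Δ)) ⟩
          2 * Δ + length xs * (2 * Δ) ∎
      ; ∈ends  = λ { (here refl) r d → ∈-++⁺ˡ (E.∈ends (here refl) r d)
                   ; (there x∈)  r d → ∈-++⁺ʳ E.ends (F.∈ends x∈ r d) }
      ; ∈outer = λ { (here refl) r d e ne → ∈-++⁺ˡ (E.∈outer (here refl) r d e ne)
                   ; (there x∈)  r d e ne → ∈-++⁺ʳ E.outer (F.∈outer x∈ r d e ne) }
      }
      where
      module E = Ends E
      module F = Ends F
      open ≤-Reasoning
      open +-*-Solver

    -- A vertex alone in its component has at most Δ ≤ 2Δ - 2 neighbours, by `2≤Δ`; otherwise each
    -- of the two ends has at most Δ - 1 neighbours of other colours.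
    ends-of : ∀ {x} → mdeg f x ≤ 1 → Ends (x ∷ [])
    ends-of {x} d with Path.path-end f (mdeg≤2 (proj₁ opt)) x d
    ... | record { nonempty = inj₁ only } = record
      { ends   = x ∷ []
      ; outer  = nbrs x
      ; ends≤  = s≤s z≤n
      ; outer≤ = ≤-trans (+-mono-≤ (degree≤ x) 2≤Δ)
                   (≤-reflexive (solve 1 (λ a → a :+ a := con 1 :* (con 2 :* a)) refl Δ))
      ; ∈ends  = λ { (here refl) r _ → here (only _ r) }
      ; ∈outer = λ { (here refl) r _ e _ → ∈nbrs⁺ (subst (λ z → Adj z _) (only _ r) e) }
      }
      where open +-*-Solver
    ... | record { end = y ; deficient = def ; nonempty = inj₂ (dx , dy) } = record
      { ends   = x ∷ y ∷ []
      ; outer  = others f x ++ others f y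
      ; ends≤  = s≤s (s≤s z≤n)
      ; outer≤ = begin
          length (others f x ++ others f y) + 2
            ≡⟨ cong (_+ 2) (length-++ (others f x)) ⟩
          (length (others f x) + length (others f y)) + 2
            ≡⟨ solve 2 (λ a b → (a :+ b) :+ con 2 := (con 1 :+ a) :+ (con 1 :+ b)) refl (length (others f x)) _ ⟩
          suc (length (others f x)) + suc (length (others f y))
            ≤⟨ +-mono-≤ (others+1≤Δ f x dx) (others+1≤Δ f y dy) ⟩
          Δ + Δ
            ≡⟨ solve 1 (λ a → a :+ a := con 1 :* (con 2 :* a)) refl Δ ⟩
          1 * (2 * Δ) ∎
      ; ∈ends  = λ { (here refl) r d → case def r d of λ { (inj₁ e) → here e ; (inj₂ e) → there (here e) } }
      ; ∈outer = λ { (here refl) r d e ne → case def r d of λ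
          { (inj₁ refl) → ∈-++⁺ˡ (∈others e ne) ; (inj₂ refl) → ∈-++⁺ʳ (others f x) (∈others e ne) } }
      }
      where
      open ≤-Reasoning
      open +-*-Solver

    ends-all : ∀ xs → (∀ {x} → x ∈ xs → mdeg f x ≤ 1) → Ends xs
    ends-all [] _ = record
      { ends = [] ; outer = [] ; ends≤ = z≤n ; outer≤ = z≤n ; ∈ends = λ () ; ∈outer = λ () }
    ends-all (x ∷ xs) h = ends-++ (ends-of (h (here refl))) (ends-all xs (h ∘ there))

    -- The summand `length Γ` in `many` has two uses: it leaves an unblocked vertex when `Γ` is
    -- nonempty, and it bounds the length of `Γ` by `n`.
    record Survey (Γ : List Entry) : Set where
      field
        inside   : List (Fin n)
        blocked  : List (Fin n)
        unique   : Unique inside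
        interior : ∀ {u} → u ∈ inside → 2 ≤ mdeg f u
        within   : ∀ {u} → u ∈ inside → Any (InJ° f u) Γ
        clear    : ∀ {u a} → Movable f u a → u ∉ blocked → All (Clear f u a) Γ
        many     : length blocked + length Γ ≤ length inside

    -- Apart from `v`, the large set has at least 5Δ + 1 vertices, each inside or a path end.
    -- Blocked are at most Δ neighbours of `v` and the outer vertices of at most two paths. In
    -- `count` the ends are added to both sides, so that `ends≤` and `outer≤` combine to exactly 5Δ
    -- + 1.
    survey-entry : ∀ {v a β} → 5 * Δ < c → Movable f v a → c < J-size f v a → Survey ((v , a , β) ∷ [])
    survey-entry {v} {a} {β} 5Δ<c mv big = record
      { inside   = I
      ; blocked  = nbrs v ++ E.outer
      ; unique   = Unique.filter⁺ P? (comp-unique g v)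
      ; interior = λ u∈ → proj₂ (proj₂ (∈-filter⁻ P? {xs = comp g v} u∈))
      ; within   = λ u∈ → let u∈c , u≢v , _ = ∈-filter⁻ P? {xs = comp g v} u∈ in here (∈comp⁻ u∈c , u≢v)
      ; clear    = λ mu u∉ → (λ {w} j e a≡b → u∉ (conflict mu j e a≡b)) ∷ []
      ; many     = +-cancelʳ-≤ (length E.ends) _ _ count
      }
      where
      g : Colouring n
      g = f [ v ≔ a ]
      P? : Decidable (λ w → w ≢ v × 2 ≤ mdeg f w)
      P? w = ¬? (w Fin.≟ v) ×-dec (2 ≤? mdeg f w)
      I : List (Fin n)
      I = filter P? (comp g v)
      targets : List (Fin n)
      targets = class f v a
      E : Ends targets
      E = ends-all targets (target-deficient opt mv)
      module E = Ends E
      -- If `w` is not `v`, it has the very colour that `u` is to receive, so `target-deficient`,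
      -- applied to `u`, makes `w` a path end. Hence neighbours of inner path vertices need not be
      -- excluded, however long the paths are.
      conflict : ∀ {u b w} → Movable f u b → J f v a w → Adj u w → b ≡ a → u ∈ nbrs v ++ E.outer
      conflict {u} {b} {w} mu j e refl with w Fin.≟ v
      ... | yes refl = ∈-++⁺ˡ (∈nbrs⁺ (adj-sym e))
      ... | no w≢v with J°-seed (j , w≢v)
      ...   | x , x∈ , r = ∈-++⁺ʳ (nbrs v) (E.∈outer x∈ r (target-deficient opt mu (∈class⁺ e fw≡a)) (adj-sym e)
                              λ fu≡fw → new mu (trans (sym fw≡a) (sym fu≡fw)))
        where
        fw≡a : f w ≡ a
        fw≡a = J°-colour (j , w≢v)
      covered : ∀ {w} → w ∈ comp g v → w ∈ v ∷ E.ends ++ I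
      covered {w} w∈ with w Fin.≟ v
      ... | yes refl = here refl
      ... | no w≢v with 2 ≤? mdeg f w
      ...   | yes d≥2 = there (∈-++⁺ʳ E.ends (∈-filter⁺ P? w∈ (w≢v , d≥2)))
      ...   | no d≱2 with J°-seed (∈comp⁻ w∈ , w≢v)
      ...     | x , x∈ , r = there (∈-++⁺ˡ (E.∈ends x∈ r (≤-pred (≰⇒> d≱2))))
      open ≤-Reasoning
      lower : suc (5 * Δ) ≤ length I + length E.ends
      lower = ≤-pred (begin
        suc (suc (5 * Δ))                ≤⟨ s≤s 5Δ<c ⟩
        suc c                            ≤⟨ big ⟩
        J-size f v a                     ≤⟨ unique⊆⇒length≤ (comp-unique g v) covered ⟩
        suc (length (E.ends ++ I))       ≡⟨ cong suc (length-++ E.ends) ⟩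
        suc (length E.ends + length I)   ≡⟨ cong suc (+-comm (length E.ends) _) ⟩
        suc (length I + length E.ends)   ∎)
      count : (length (nbrs v ++ E.outer) + 1) + length E.ends ≤ length I + length E.ends
      count = begin
        (length (nbrs v ++ E.outer) + 1) + length E.ends
          ≡⟨ cong (λ z → (z + 1) + length E.ends) (length-++ (nbrs v)) ⟩
        ((length (nbrs v) + length E.outer) + 1) + length E.ends
          ≤⟨ +-mono-≤ (+-monoˡ-≤ 1 (+-monoˡ-≤ (length E.outer) (degree≤ v))) E.ends≤ ⟩
        ((Δ + length E.outer) + 1) + length targets * 2
          ≡⟨ solve 3 (λ d o t → ((d :+ o) :+ con 1) :+ t := (d :+ con 1) :+ (o :+ t)) refl Δ (length E.outer) _ ⟩
        (Δ + 1) + (length E.outer + length targets * 2)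
          ≤⟨ +-monoʳ-≤ (Δ + 1) (≤-trans E.outer≤ (*-monoˡ-≤ (2 * Δ) (cnt≤2 mv))) ⟩
        (Δ + 1) + 2 * (2 * Δ)
          ≡⟨ solve 1 (λ d → (d :+ con 1) :+ con 2 :* (con 2 :* d) := con 1 :+ con 5 :* d) refl Δ ⟩
        suc (5 * Δ)
          ≤⟨ lower ⟩
        length I + length E.ends ∎
        where open +-*-Solver

    -- Disjointness lets the inside lists add up without repetition.
    survey-∷ : ∀ {e Γ} → Survey (e ∷ []) → Survey Γ → (∀ {u} → InJ° f u e → ¬ Any (InJ° f u) Γ) → Survey (e ∷ Γ)
    survey-∷ {e} {Γ} S T disj = record
      { inside   = S.inside ++ T.inside
      ; blocked  = S.blocked ++ T.blocked
      ; unique   = Unique.++⁺ S.unique T.unique λ (s , t) → case S.within s of λ { (here j) → disj j (T.within t) }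
      ; interior = λ u∈ → case ∈-++⁻ S.inside u∈ of λ { (inj₁ s) → S.interior s ; (inj₂ t) → T.interior t }
      ; within   = λ u∈ → case ∈-++⁻ S.inside u∈ of λ
          { (inj₁ s) → case S.within s of λ { (here j) → here j } ; (inj₂ t) → there (T.within t) }
      ; clear    = λ m u∉ → All.head (S.clear m (u∉ ∘ ∈-++⁺ˡ)) ∷ T.clear m (u∉ ∘ ∈-++⁺ʳ S.blocked)
      ; many     = begin
          length (S.blocked ++ T.blocked) + suc (length Γ)
            ≡⟨ cong (_+ suc (length Γ)) (length-++ S.blocked) ⟩
          (length S.blocked + length T.blocked) + suc (length Γ)
            ≡⟨ solve 3 (λ a b c → (a :+ b) :+ (con 1 :+ c) := (a :+ con 1) :+ (b :+ c)) refl (length S.blocked) _ (length Γ) ⟩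
          (length S.blocked + 1) + (length T.blocked + length Γ)
            ≤⟨ +-mono-≤ S.many T.many ⟩
          length S.inside + length T.inside
            ≡⟨ sym (length-++ S.inside) ⟩
          length (S.inside ++ T.inside) ∎
      }
      where
      module S = Survey S
      module T = Survey T
      open ≤-Reasoning
      open +-*-Solver

    survey-[] : Survey []
    survey-[] = record
      { inside = [] ; blocked = [] ; unique = [] ; interior = λ () ; within = λ () ; clear = λ _ _ → [] ; many = z≤n }

  -- Searching for a drop in energy.

  proper-upd : ∀ {f v a} → IsLColouring L f → a ∈ L v → IsLColouring L (f [ v ≔ a ])
  proper-upd {f} {v} {a} p a∈ w with w Fin.≟ v
  ... | yes refl = subst (_∈ L v) (sym (upd-at f v a)) a∈
  ... | no w≢v   = subst (_∈ L w) (sym (upd-off f a w≢v)) (p w)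

  locOpt? : ∀ f → LocOpt f ⊎ ∃[ v ] ∃[ a ] a ∈ L v × cnt f v a < mdeg f v
  locOpt? f with scan {P = λ v → ∀ {a} → a ∈ L v → mdeg f v ≤ cnt f v a}
                      {Q = λ v → ∃[ a ] a ∈ L v × cnt f v a < mdeg f v} at (allFin n)
    where
    at : ∀ v → (∀ {a} → a ∈ L v → mdeg f v ≤ cnt f v a) ⊎ ∃[ a ] a ∈ L v × cnt f v a < mdeg f v
    at v = scan (λ a → ≤-<-connex (mdeg f v) (cnt f v a)) (L v)
  ... | inj₁ opt                     = inj₁ λ v → opt (∈-allFin v)
  ... | inj₂ (v , _ , a , a∈ , lt) = inj₂ (v , a , a∈ , lt)

  opt? : ∀ f → IsLColouring L f → Opt f ⊎ ∃[ g ] IsLColouring L g × energy g < energy f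
  opt? f p with locOpt? f
  ... | inj₂ (v , a , a∈ , lt) = inj₂ (f [ v ≔ a ] , proper-upd p a∈ , energy-< f v a lt)
  ... | inj₁ opt with scan {P = λ v → ∀ {a} → a ∈ L v → cnt f v a ≤ mdeg f v → LocOpt (f [ v ≔ a ])} at (allFin n)
    where
    Improvement : Set
    Improvement = ∃[ g ] IsLColouring L g × energy g < energy f
    second : ∀ v {a} → a ∈ L v → (cnt f v a ≤ mdeg f v → LocOpt (f [ v ≔ a ])) ⊎ Improvement
    second v {a} a∈ with cnt f v a ≤? mdeg f v
    ... | no ¬le = inj₁ λ le → contradiction le ¬le
    ... | yes le with locOpt? (f [ v ≔ a ])
    ...   | inj₁ opt₂ = inj₁ λ _ → opt₂
    ...   | inj₂ (w , b , b∈ , lt) = inj₂ (f [ v ≔ a ] [ w ≔ b ] , proper-upd (proper-upd p a∈) b∈ ,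
                                          <-≤-trans (energy-< (f [ v ≔ a ]) w b lt) (energy-≤ f v a le))
    -- `scan` does not pass the membership `a ∈ L v` to its test, so the colours are traversed by
    -- hand.
    over : ∀ v {as} → (∀ {a} → a ∈ as → a ∈ L v) →
           (∀ {a} → a ∈ as → cnt f v a ≤ mdeg f v → LocOpt (f [ v ≔ a ])) ⊎ Improvement
    over v {[]} sub = inj₁ λ ()
    over v {a ∷ as} sub with second v (sub (here refl)) | over v (sub ∘ there)
    ... | inj₂ imp | _        = inj₂ imp
    ... | inj₁ _   | inj₂ imp = inj₂ imp
    ... | inj₁ x   | inj₁ xs  = inj₁ λ { (here refl) → x ; (there a∈) → xs a∈ }
    at : ∀ v → (∀ {a} → a ∈ L v → cnt f v a ≤ mdeg f v → LocOpt (f [ v ≔ a ])) ⊎ Improvement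
    at v = over v λ a∈ → a∈
  ...   | inj₁ opt₂          = inj₁ (opt , λ v → opt₂ (∈-allFin v))
  ...   | inj₂ (_ , _ , imp) = inj₂ imp

  1≤k : 1 ≤ k
  1≤k = n≢0⇒n>0 λ { refl → case ≤-trans (m≤n+m 2 Δ) Δ+2≤3k of λ () }

  interior⇒2≤Δ : ∀ {f v} → LocOpt f → 2 ≤ mdeg f v → 2 ≤ Δ
  interior⇒2≤Δ opt d = ≤-trans (*-monoˡ-≤ 2 1≤k) (interior⇒2k≤Δ opt d)

  -- If all degrees were at most 1, the component would consist of `r` and the other end of its
  -- path, at most 2 ≤ c vertices.
  giant-interior : ∀ {f r} → LocOpt f → c < size f r → ∃[ u ] MonoReach G f r u × 2 ≤ mdeg f u
  giant-interior {f} {r} opt big with scan {Q = λ z → 2 ≤ mdeg f z} (λ z → swap (≤-<-connex 2 (mdeg f z))) (comp f r)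
  ... | inj₂ (u , u∈ , d) = u , ∈comp⁻ u∈ , d
  ... | inj₁ small = contradiction big (≤⇒≯ (≤-trans (unique⊆⇒length≤ (comp-unique f r) sub) 2≤c))
    where
    deficient : ∀ {z} → MonoReach G f r z → mdeg f z ≤ 1
    deficient q = ≤-pred (small (∈comp⁺ q))
    open Path f (mdeg≤2 opt) r (deficient here) using (path-end; module End)
    sub : ∀ {z} → z ∈ comp f r → z ∈ r ∷ End.end path-end ∷ []
    sub z∈ with End.deficient path-end (∈comp⁻ z∈) (deficient (∈comp⁻ z∈))
    ... | inj₁ e = here e
    ... | inj₂ e = there (here e)

  -- The list of candidates and its invariants.

  module Descent (E₀ g₀ : ℕ) where

    -- `E₀` and `g₀` stay fixed during one search, while the colouring may change many times without
    -- exceeding them.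
    record Base (f : Colouring n) : Set where
      constructor mkBase
      field
        proper : IsLColouring L f
        energy≤ : energy f ≤ E₀
        giants≤ : length (giants f) ≤ g₀

    record Better (f : Colouring n) : Set where
      constructor better
      field
        proper : IsLColouring L f
        less   : energy f < E₀ ⊎ energy f ≤ E₀ × length (giants f) < g₀

    -- Lists grow at the head, so `Γ` holds the entries older than `e`.
    record Candidate (f : Colouring n) (Γ : List Entry) (e : Entry) : Set where
      constructor candidate
      private
        v = proj₁ e
        a = proj₁ (proj₂ e)
        b = proj₂ (proj₂ e)
      field
        mov     : Movable f v a
        small   : J-size f v a ≤ b
        clear   : All (Clear f v a) Γ
        located : Located f v Γ

    Valid : Colouring n → List Entry → Set
    Valid f []      = Base f
    Valid f (e ∷ Γ) = Candidate f Γ e × Valid f Γ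

    valid-base : ∀ {f} Γ → Valid f Γ → Base f
    valid-base []      b       = b
    valid-base (_ ∷ Γ) (_ , v) = valid-base Γ v

    -- Progress is a better colouring, or a smaller variant at one entry with all older entries
    -- still valid. The constructor `there` forgets newer entries.
    data Hit (f : Colouring n) : List Entry → Set where
      base  : ∀ {Γ} → Better f → Hit f Γ
      here  : ∀ {v a b Γ} → Valid f ((v , a , b) ∷ Γ) → Hit f ((v , a , suc b) ∷ Γ)
      there : ∀ {e Γ} → Hit f Γ → Hit f (e ∷ Γ)

    InJ°-closed : ∀ {f x y} Γ → Valid f Γ → MonoReach G f x y → Any (InJ° f x) Γ → Any (InJ° f y) Γ
    InJ°-closed (e ∷ Γ) (cand , _) r (here j)  = here (J°-closed (new (Candidate.mov cand)) j r)
    InJ°-closed (e ∷ Γ) (_ , val)  r (there p) = there (InJ°-closed Γ val r p)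

    -- The effect of one recolouring on giants and entries.

    module Move (f : Colouring n) (u : Fin n) (a : ℕ) (m : Movable f u a) (free : J-size f u a ≤ c) where

      f′ : Colouring n
      f′ = f [ u ≔ a ]

      transfer : ∀ {g h : Colouring n} {s w} → (∀ {z} → z ≢ u → g z ≡ h z) →
                 ¬ MonoReach G g s u → MonoReach G g s w → MonoReach G h s w
      transfer eq ¬r here = here
      transfer eq ¬r (step e c r) =
        step e (trans (sym (eq λ { refl → ¬r here })) (trans c (eq λ { refl → ¬r (step e c here) })))
          (transfer eq (λ r′ → ¬r (step e c r′)) r)

      off : ∀ {z} → z ≢ u → f′ z ≡ f z
      off = upd-off f a

      -- By `free`, a giant after the move avoids `u`, so its walks existed before the move.
      giant-old : ∀ {w} → c < size f′ w → c < size f w × w ≢ u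
      giant-old {w} big = ≤-trans big (size-mono (transfer off ¬r)) , λ { refl → ¬r here }
        where
        ¬r : ¬ MonoReach G f′ w u
        ¬r r = contradiction free (<⇒≱ (≤-trans big (≤-reflexive (reach-equiv-size r))))

      giants-sub : ∀ {w} → w ∈ giants f′ → w ∈ giants f
      giants-sub w∈ = ∈giants⁺ (proj₁ (giant-old (∈giants⁻ w∈)))

      proper′ : IsLColouring L f → IsLColouring L f′
      proper′ p w with w Fin.≟ u
      ... | yes refl = subst (_∈ L u) (sym (upd-at f u a)) (allowed m)
      ... | no w≢u   = subst (_∈ L w) (sym (off w≢u)) (p w)

      base′ : Base f → Base f′
      base′ (mkBase p e g) = mkBase (proper′ p) (≤-trans (energy-≤ f u a (cnt≤mdeg m)) e)
        (≤-trans (unique⊆⇒length≤ (unique-giants f′) giants-sub) g)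

      better′ : c < size f u → Base f → Better f′
      better′ big (mkBase p e g) = better (proper′ p) (inj₂ (≤-trans (energy-≤ f u a (cnt≤mdeg m)) e ,
        ≤-trans (unique⊂⇒length< (unique-giants f′) giants-sub (∈giants⁺ big) λ u∈ → proj₂ (giant-old (∈giants⁻ u∈)) refl) g))

      module _ (v : Fin n) (b : ℕ) where

        off-J : ∀ {z} → z ≢ u → (f′ [ v ≔ b ]) z ≡ (f [ v ≔ b ]) z
        off-J {z} z≢u with z Fin.≟ v
        ... | yes refl = trans (upd-at f′ v b) (sym (upd-at f v b))
        ... | no z≢v   = trans (upd-off f′ b z≢v) (trans (off z≢u) (sym (upd-off f b z≢v)))

        -- A walk from `v` could first enter `u` only from a vertex of the old set and only if `a`
        -- equals `b`, which is what clearness forbids.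
        J-shrinks : ∀ {w} → v ≢ u → (∀ {w} → J f v b w → Adj u w → a ≢ b) → J f′ v b w → J f v b w × w ≢ u
        J-shrinks v≢u cl = reach-closed (λ w → J f v b w × w ≢ u) one (here , v≢u)
          where
          one : ∀ {x y} → J f v b x × x ≢ u → Mono (f′ [ v ≔ b ]) x y → J f v b y × y ≢ u
          one {x} {y} (j , x≢u) (e , col) = reach-snoc j (e , trans (sym (off-J x≢u)) (trans col (off-J y≢u))) , y≢u
            where
            y≢u : y ≢ u
            y≢u refl = cl j (adj-sym e) (begin
              a                 ≡⟨ sym (upd-at f u a) ⟩
              f′ u              ≡⟨ sym (upd-off f′ b (v≢u ∘ sym)) ⟩
              (f′ [ v ≔ b ]) u  ≡⟨ sym col ⟩
              (f′ [ v ≔ b ]) x  ≡⟨ off-J x≢u ⟩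
              (f [ v ≔ b ]) x   ≡⟨ sym (reach-colour j) ⟩
              (f [ v ≔ b ]) v   ≡⟨ upd-at f v b ⟩
              b                 ∎)
              where open ≡-Reasoning

        J-kept : ∀ {w} → ¬ J f v b u → J f v b w → J f′ v b w
        J-kept = transfer λ z≢u → sym (off-J z≢u)

      Avoids : Entry → Set
      Avoids (v , b , _) = ¬ J f v b u

      clear-kept : ∀ {v b Γ} → All (Clear f u a) Γ → All Avoids Γ → All (Clear f v b) Γ → All (Clear f′ v b) Γ
      clear-kept []         []         []         = []
      clear-kept (cl ∷ cls) (av ∷ avs) (cv ∷ cvs) =
        (λ j e → cv (proj₁ (J-shrinks _ _ (λ { refl → av here }) cl j)) e) ∷ clear-kept cls avs cvs

      module _ (¬giant : ¬ c < size f u) where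

        -- The giant or older set in which `v` lies is closed under reachability and does not
        -- contain `u`.
        unreached : ∀ {v} Γ → Valid f Γ → All Avoids Γ → Located f v Γ → ¬ MonoReach G f v u
        unreached Γ val avs (inj₁ big) r = ¬giant (≤-trans big (≤-reflexive (reach-equiv-size r)))
        unreached Γ val avs (inj₂ p)   r = all-any (λ av j → av (proj₁ j)) avs (InJ°-closed Γ val r p)

        -- Clearness keeps `u` from becoming a neighbour of `v` of colour `b`; as `u` is unreached,
        -- `v` loses no monochromatic neighbour.
        movable-kept : ∀ {v b} → ¬ MonoReach G f v u → (∀ {w} → J f v b w → Adj u w → a ≢ b) → Movable f v b → Movable f′ v b
        movable-kept {v} {b} ¬r cl mv = record
          { allowed  = allowed mv
          ; new      = λ e → new mv (trans e (off v≢u))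
          ; cnt≤2    = ≤-trans (unique⊆⇒length≤ (unique-class f′ v b) fewer) (cnt≤2 mv)
          ; interior = ≤-trans (interior mv) (unique⊆⇒length≤ (unique-class f v (f v)) more)
          }
          where
          v≢u : v ≢ u
          v≢u refl = ¬r here
          fewer : ∀ {w} → w ∈ class f′ v b → w ∈ class f v b
          fewer {w} w∈ with ∈class⁻ w∈ | w Fin.≟ u
          ... | e , col | no w≢u   = ∈class⁺ e (trans (sym (off w≢u)) col)
          ... | e , col | yes refl = contradiction (trans (sym (upd-at f u a)) col) (cl here (adj-sym e))
          more : ∀ {w} → w ∈ mono-nbrs f v → w ∈ mono-nbrs f′ v
          more {w} w∈ with ∈mono⁻ w∈ | w Fin.≟ u
          ... | e , col | no w≢u   = ∈mono⁺ (e , trans (off v≢u) (trans col (sym (off w≢u))))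
          ... | e , col | yes refl = contradiction (step e col here) ¬r

        -- Recursing before deciding treats the oldest entries first, so a hit occurs at the oldest
        -- set containing `u`. This set loses `u`, and the older ones, which avoid `u`, keep their
        -- entries valid.
        settle : ∀ Γ → Valid f Γ → All (Clear f u a) Γ → (Valid f′ Γ × All Avoids Γ) ⊎ Hit f′ Γ
        settle [] val [] = inj₁ (base′ val , [])
        settle ((v , b , β) ∷ Γ) (cand , val) (cl ∷ cls) with settle Γ val cls
        ... | inj₂ hit = inj₂ (there hit)
        ... | inj₁ (val′ , avs) = decide (J? f v b u)
          where
          open Candidate cand
          ¬r = unreached Γ val avs located
          v≢u : v ≢ u
          v≢u refl = ¬r here
          shrinks : ∀ {w} → J f′ v b w → J f v b w × w ≢ u
          shrinks = J-shrinks v b v≢u cl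
          located′ : Located f v Γ → Located f′ v Γ
          located′ (inj₁ big) = inj₁ (≤-trans big (size-mono (transfer (λ z≢u → sym (off z≢u)) ¬r)))
          located′ (inj₂ p)   = inj₂ (any-all (λ av j → J-kept _ _ av (proj₁ j) , proj₂ j) avs p)
          valid′ : ∀ {β} → J-size f′ v b ≤ β → Valid f′ ((v , b , β) ∷ Γ)
          valid′ le = candidate (movable-kept ¬r cl mov) le (clear-kept cls avs clear) (located′ located) , val′
          drop : ∀ β → J-size f′ v b < β → Hit f′ ((v , b , β) ∷ Γ)
          drop (suc β) (s≤s le) = here (valid′ le)
          decide : Dec (J f v b u) → (Valid f′ ((v , b , β) ∷ Γ) × All Avoids ((v , b , β) ∷ Γ)) ⊎ Hit f′ ((v , b , β) ∷ Γ)
          decide (no ¬j) = inj₁ (valid′ (≤-trans (size-mono λ j → proj₁ (shrinks j)) small) , ¬j ∷ avs)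
          decide (yes j) = inj₂ (drop β (<-≤-trans (size-strict (λ i → proj₁ (shrinks i)) j λ i → proj₂ (shrinks i) refl) small))

      -- If `u` is in a giant, the number of giant vertices drops. Otherwise `u` is in some set, so
      -- `settle` cannot find that all sets avoid it.
      move : ∀ Γ → Valid f Γ → All (Clear f u a) Γ → Located f u Γ → Hit f′ Γ
      move Γ val cls loc with c <? size f u
      ... | yes big = base (better′ big (valid-base Γ val))
      ... | no ¬big with settle ¬big Γ val cls | loc
      ...   | inj₂ hit       | _        = hit
      ...   | inj₁ _         | inj₁ big = contradiction big ¬big
      ...   | inj₁ (_ , avs) | inj₂ p   = contradiction p (all-any (λ av j → av (proj₁ j)) avs)

    -- The recursive search.

    Blocked : Colouring n → Entry → Set
    Blocked f (v , a , _) = c < J-size f v a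

    Result : List Entry → Set
    Result Γ = ∃[ f ] Hit f Γ

    blocked? : ∀ {f} Γ → Valid f Γ → All (Blocked f) Γ ⊎ Result Γ
    blocked? [] _ = inj₁ []
    blocked? {f} ((v , a , β) ∷ Γ) (cand , val) with J-size f v a ≤? c | blocked? Γ val
    ... | _        | inj₂ (g , hit) = inj₂ (g , there hit)
    ... | no ¬free | inj₁ bl        = inj₁ (≰⇒> ¬free ∷ bl)
    ... | yes free | inj₁ _         = inj₂ (_ , there (Move.move f v a mov free Γ val clear located))
      where open Candidate cand

    -- From a common vertex, closure carries a seed `x` adjacent to `v` into an older set; the two
    -- target colours then agree, against `Clear`.
    disjoint : ∀ {f e Γ u} → Candidate f Γ e → Valid f Γ → InJ° f u e → ¬ Any (InJ° f u) Γ
    disjoint {Γ = Γ} cand val j p with J°-seed j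
    ... | x , x∈ , r with ∈class⁻ x∈
    ...   | v~x , fx≡a = all-any (λ cl i → cl (proj₁ i) v~x (trans (sym fx≡a) (J°-colour i)))
                                 (Candidate.clear cand) (InJ°-closed Γ val (reach-sym r) p)

    survey : ∀ {f} Γ (opt : Opt f) (2≤Δ : 2 ≤ Δ) → 5 * Δ < c → Valid f Γ → All (Blocked f) Γ → Zone.Survey f opt 2≤Δ Γ
    survey []      opt 2≤Δ 5Δ<c val [] = Zone.survey-[] _ opt 2≤Δ
    survey (e ∷ Γ) opt 2≤Δ 5Δ<c (cand , val) (big ∷ bl) =
      Zone.survey-∷ _ opt 2≤Δ (Zone.survey-entry _ opt 2≤Δ 5Δ<c (Candidate.mov cand) big)
        (survey Γ opt 2≤Δ 5Δ<c val bl) (disjoint cand val)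

    mutual
      -- The recursion is lexicographic: `m`, the room left for entries, drops with each new entry,
      -- and at fixed `m` the variant of the newest entry drops in `push`.
      solve : ∀ m e Γ f → n < m + suc (length Γ) → Valid f (e ∷ Γ) → Result (e ∷ Γ)
      solve m e Γ f lt val with valid-base (e ∷ Γ) val
      ... | mkBase p energy≤ _ with opt? f p
      ...   | inj₂ (g , q , less) = g , base (better q (inj₁ (<-≤-trans less energy≤)))
      ...   | inj₁ opt with blocked? (e ∷ Γ) val
      ...     | inj₂ hit = hit
      ...     | inj₁ bl  = extend m e Γ f lt val opt bl

      extend : ∀ m e Γ f → n < m + suc (length Γ) → Valid f (e ∷ Γ) → Opt f → All (Blocked f) (e ∷ Γ) → Result (e ∷ Γ)
      extend m e Γ f lt val@(cand , _) opt bl = go m lt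
        where
        d = interior (Candidate.mov cand)
        2≤Δ = interior⇒2≤Δ (proj₁ opt) d
        module S = Zone.Survey (survey (e ∷ Γ) opt 2≤Δ (2k≤Δ⇒5Δ<c (interior⇒2k≤Δ (proj₁ opt) d)) val bl)
        go : ∀ m → n < m + suc (length Γ) → Result (e ∷ Γ)
        -- There are at least as many distinct inside vertices as entries, so the list cannot
        -- outgrow `n`.
        go zero lt = contradiction (≤-trans (m+n≤o⇒n≤o (length S.blocked) S.many) (unique-length≤n S.unique)) (<⇒≱ lt)
        go (suc m) lt with pigeonhole S.unique (≤-trans (≤-trans (≤-reflexive (+-comm 1 _)) (+-monoʳ-≤ (length S.blocked) (s≤s z≤n))) S.many)
        ... | u , u∈ , u∉ with movable-colour (S.interior u∈)
        ...   | a , mv = push m u a (J-size f u a) (e ∷ Γ) f (≤-trans lt (≤-reflexive (sym (+-suc m _))))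
                           (candidate mv ≤-refl (S.clear mv u∉) (inj₂ (S.within u∈)) , val)

      push : ∀ m u a b Γ f → n < m + suc (length Γ) → Valid f ((u , a , b) ∷ Γ) → Result Γ
      -- At variant zero no `here` can occur, since its index is a successor.
      push m u a zero Γ f lt val with solve m (u , a , zero) Γ f lt val
      ... | g , base bt   = g , base bt
      ... | g , there hit = g , hit
      push m u a (suc b) Γ f lt val with solve m (u , a , suc b) Γ f lt val
      ... | g , base bt   = g , base bt
      ... | g , there hit = g , hit
      ... | g , here val′ = push m u a b Γ g lt val′

    descend : ∀ f → Base f → ∀ r → c < size f r → ∃[ g ] Better g
    descend f bs r big with opt? f (Base.proper bs)
    ... | inj₂ (g , q , less) = g , better q (inj₁ (<-≤-trans less (Base.energy≤ bs)))
    ... | inj₁ opt with giant-interior (proj₁ opt) big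
    ...   | u , reach , d with movable-colour d
    ...     | a , mv with push n u a (J-size f u a) [] f (≤-reflexive (+-comm 1 n))
                            (candidate mv ≤-refl [] (inj₁ (≤-trans big (≤-reflexive (reach-equiv-size reach)))) , bs)
    ...       | g , base bt = g , bt

  -- Lexicographic descent on the energy bound and the number of giant vertices.

  clustered : ∀ {E} f → IsLColouring L f → energy f ≤ E → Acc _<_ E →
              Σ (Colouring n) λ g → IsLColouring L g × HasClustering G g c
  clustered {E} f p f≤E (acc rec-E) = fewer-giants f p f≤E (<-wellFounded _)
    where
    fewer-giants : ∀ f → IsLColouring L f → energy f ≤ E → Acc _<_ (length (giants f)) →
                   Σ (Colouring n) λ g → IsLColouring L g × HasClustering G g c
    fewer-giants f p f≤E (acc rec-g) with scan {Q = λ v → c < size f v} (λ v → ≤-<-connex (size f v) c) (allFin n)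
    ... | inj₁ small = f , p , λ v ws u reach →
      ≤-trans (unique⊆⇒length≤ u λ w∈ → ∈comp⁺ (All.lookup reach w∈)) (small (∈-allFin v))
    ... | inj₂ (r , _ , big) with Descent.descend E (length (giants f)) f (Descent.mkBase p f≤E ≤-refl) r big
    ...   | g , Descent.better q (inj₁ less)          = clustered g q ≤-refl (rec-E less)
    -- `E` stays fixed here as an upper bound; it is reset only when the energy falls below it.
    ...   | g , Descent.better q (inj₂ (g≤E , fewer)) = fewer-giants g q g≤E (rec-g fewer)

  exists-clustered : Σ (Colouring n) λ g → IsLColouring L g × HasClustering G g c
  exists-clustered = clustered (λ v → proj₁ (first v)) (λ v → proj₂ (first v)) ≤-refl (<-wellFounded _)
    where
    head : ∀ (as : List ℕ) → 1 ≤ length as → ∃[ a ] a ∈ as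
    head (a ∷ _) _ = a , here refl
    first : ∀ v → ∃[ a ] a ∈ L v
    first v = head (L v) (≤-trans 1≤k (k≤L v))

-- Arithmetic of the two bounds.

Δ+2≤3⌈Δ+2/3⌉ : ∀ Δ → Δ + 2 ≤ ceil-Δ+2/3 Δ * 3
-- Adding 2 reduces the claim to division of Δ + 4 by 3 with remainder at most 2.
Δ+2≤3⌈Δ+2/3⌉ Δ = +-cancelʳ-≤ 2 (Δ + 2) _ (begin
  Δ + 2 + 2                             ≡⟨ +-assoc Δ 2 2 ⟩
  Δ + 4                                 ≡⟨ m≡m%n+[m/n]*n (Δ + 4) 3 ⟩
  (Δ + 4) % 3 + ceil-Δ+2/3 Δ * 3        ≤⟨ +-monoˡ-≤ _ (≤-pred (m%n<n (Δ + 4) 3)) ⟩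
  2 + ceil-Δ+2/3 Δ * 3                  ≡⟨ +-comm 2 _ ⟩
  ceil-Δ+2/3 Δ * 3 + 2                  ∎)
  where open ≤-Reasoning

-- Doubled, this is 10Δ + 36 ≤ 19Δ, that is 4 ≤ Δ. It is tight at Δ = 4, where the two sides are 20
-- and 21.
5Δ<clusterBound : ∀ Δ → 4 ≤ Δ → 5 * Δ < clusterBound Δ
5Δ<clusterBound Δ 4≤Δ = m+n≤o⇒m≤o∸n (suc (5 * Δ)) (begin
  suc (5 * Δ) + 17                        ≡⟨ n≡⌈n+n/2⌉ _ ⟩
  ⌈ (suc (5 * Δ) + 17) + (suc (5 * Δ) + 17) /2⌉ ≤⟨ ⌈n/2⌉-mono (begin
    (suc (5 * Δ) + 17) + (suc (5 * Δ) + 17)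
      ≡⟨ solve 1 (λ d → ((con 1 :+ con 5 :* d) :+ con 17) :+ ((con 1 :+ con 5 :* d) :+ con 17) := con 9 :* con 4 :+ con 10 :* d) refl Δ ⟩
    9 * 4 + 10 * Δ  ≤⟨ +-monoˡ-≤ (10 * Δ) (*-monoʳ-≤ 9 4≤Δ) ⟩
    9 * Δ + 10 * Δ  ≡⟨ sym (*-distribʳ-+ Δ 9 10) ⟩
    19 * Δ          ∎) ⟩
  ⌈ 19 * Δ /2⌉ ∎)
  where
  open ≤-Reasoning
  open +-*-Solver

2≤clusterBound : ∀ Δ → 3 ≤ Δ → 2 ≤ clusterBound Δ
2≤clusterBound Δ 3≤Δ = ≤-trans (s≤s (s≤s z≤n)) (∸-monoˡ-≤ 17 (⌈n/2⌉-mono (*-monoʳ-≤ 19 3≤Δ)))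

theorem9 : ∀ {n} (G : Graph n) (Δ : ℕ) → HasMaxDegree G Δ → 3 ≤ Δ →
    ChoosableWithClustering G (ceil-Δ+2/3 Δ) (clusterBound Δ)
theorem9 G Δ (degree≤ , _) 3≤Δ A =
  Clustering.exists-clustered G Δ (ceil-Δ+2/3 Δ) (clusterBound Δ) degree≤ (Δ+2≤3⌈Δ+2/3⌉ Δ)
    (2≤clusterBound Δ 3≤Δ) (dense (m≤n⇒m<n∨m≡n 3≤Δ)) A
  where
  dense : 3 < Δ ⊎ 3 ≡ Δ → ceil-Δ+2/3 Δ * 2 ≤ Δ → 5 * Δ < clusterBound Δ
  dense (inj₁ 4≤Δ)  _ = 5Δ<clusterBound Δ 4≤Δ
  -- Two colours are available for Δ = 3, and 4 ≤ 3 is absurd.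
  dense (inj₂ refl) (s≤s (s≤s (s≤s ())))
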